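{- (a) For every $v\geq 8$ there exists a connected symmetric configuration $v_3$ whose minimum blocking set cardinality is exactly $\lceil v/3\rceil+1$. (b) For $v=12$ and for every $v\geq 15$ there exists a connected symmetric configuration $v_3$ whose minimum blocking set cardinality is exactly $\lceil v/3\rceil+2$.
   Context: A symmetric configuration $v_3$ is a finite incidence structure consisting of a set $V$ of $v$ points and a collection of $v$ blocks, each block a $3$-element subset of $V$, such that each point lies in exactly $3$ blocks and any two distinct points lie together in at most one block. It is connected if it is not the union of two configurations on disjoint point sets. A blocking set is a subset $Q\subseteq V$ such that every block contains at least one point of $Q$ and at least one point of $V\setminus Q$. The minimum blocking set cardinality of a configuration (which has a blocking set) is the smallest cardinality of one of its blocking sets; the paper calls a blocking set of this size a minimal blocking set. -}

module Defs where

open import Data.Nat using (ℕ; _+_; _≤_)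
open import Data.Nat.DivMod using (_/_)
open import Data.Fin using (Fin)
open import Data.Fin.Subset using (Subset; _∈_; _∉_; ∣_∣)
open import Data.Product using (Σ; ∃; ∃-syntax; _×_; _,_)
open import Data.Sum using (_⊎_)
open import Relation.Binary.PropositionalEquality using (_≡_; _≢_)
open import Relation.Nullary using (¬_)

-- A symmetric configuration v_3 on the point set Fin v.
-- Blocks are indexed by Fin v (there are exactly v of them);
-- block b is given by its three points  block b 0, block b 1, block b 2.
record Config (v : ℕ) : Set where
  field
    block : Fin v → Fin 3 → Fin v
    block-distinct : ∀ b i j → block b i ≡ block b j → i ≡ j

  _∈B_ : Fin v → Fin v → Set
  p ∈B b = ∃[ i ] block b i ≡ p

  field
    -- each point lies in exactly 3 blocks: an injective enumeration
    -- of the blocks through p by Fin 3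
    through : Fin v → Fin 3 → Fin v
    through-inj : ∀ p k l → through p k ≡ through p l → k ≡ l
    through-∈ : ∀ p k → p ∈B through p k
    through-all : ∀ p b → p ∈B b → ∃[ k ] through p k ≡ b
    pair-unique : ∀ p q → p ≢ q → ∀ b b′ →
                  p ∈B b → q ∈B b → p ∈B b′ → q ∈B b′ → b ≡ b′

open Config public

-- Connected: the configuration is not the union of two configurations on
-- disjoint (nonempty) point sets, i.e. there is no partition of the points
-- into two nonempty parts S, V∖S such that every block lies entirely in one part.
Connected : ∀ {v} → Config v → Set
Connected {v} C =
  (S : Subset v) →
  (∀ b → (∀ i → block C b i ∈ S) ⊎ (∀ i → block C b i ∉ S)) →
  (∀ p → p ∉ S) ⊎ (∀ p → p ∈ S)

IsBlockingSet : ∀ {v} → Config v → Subset v → Set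
IsBlockingSet {v} C Q =
  ∀ b → (∃[ i ] block C b i ∈ Q) × (∃[ j ] block C b j ∉ Q)

MinBlockingSetSize : ∀ {v} → Config v → ℕ → Set
MinBlockingSetSize {v} C k =
  (Σ (Subset v) λ Q → IsBlockingSet C Q × ∣ Q ∣ ≡ k) ×
  (∀ Q → IsBlockingSet C Q → k ≤ ∣ Q ∣)

⌈_/3⌉ : ℕ → ℕ
⌈ v /3⌉ = (v + 2) / 3

{-# OPTIONS --safe #-}

-- Cut a flag (an incident point-block pair) in each of two configurations and
-- exchange the two points: the result is again a configuration.  The 9₃ used
-- below has exactly one set of three points meeting all blocks, and its cut flag
-- point is not in it.  Splicing it into a configuration with least blocking set
-- size k therefore yields size k + 3: a blocking set that uses the flag point of
-- the 9₃ to serve the cut block on the other side spends four points in the 9₃.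
-- As ⌈(v + 9)/3⌉ = ⌈v/3⌉ + 3, finitely many configurations remain; their least
-- blocking sets are bounded by a verified branching search.
module Submission where

open import Defs
open import Data.Bool using (Bool; true; false; T; _∧_; _∨_)
open import Data.Bool.ListAction using (any; all)
open import Data.Bool.Properties using (T-≡; T-∧; T-∨)
open import Data.Fin using (Fin; zero; suc; toℕ; _↑ˡ_; _↑ʳ_; splitAt; join)
open import Data.Fin.Properties using (_≟_; any?; all?; toℕ-injective; splitAt-join; join-splitAt)
open import Data.Fin.Subset using (Subset; _∈_; _∉_; ∣_∣; inside; outside)
open import Data.Fin.Subset.Properties using (_∈?_)
open import Data.List using (List; []; _∷_; filter; length; map; null; tabulate)
open import Data.List.Membership.Propositional using (find) renaming (_∈_ to _∈ˡ_; _∉_ to _∉ˡ_)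
open import Data.List.Membership.Propositional.Properties using (∈-filter⁺; ∈-filter⁻; ∈-map⁺; ∈-map⁻; ∈-tabulate⁺)
open import Data.List.Properties using (filter-notAll; length-map)
open import Data.List.Relation.Unary.All as All using (All; []; _∷_)
import Data.List.Relation.Unary.All.Properties as All
open import Data.List.Relation.Unary.Any as Any using (here; there)
open import Data.List.Relation.Unary.Any.Properties using (any⁻)
open import Data.Nat using (ℕ; zero; suc; _+_; _*_; _∸_; _≤_; _<_; _≤?_; _<?_; _<ᵇ_; z≤n; s≤s)
open import Data.Nat.DivMod using (_mod_; +-distrib-/-∣ˡ)
open import Data.Nat.Divisibility using (divides)
open import Data.Nat.Induction using (Acc; acc; <-wellFounded)
import Data.Nat.Properties as ℕ
open import Data.List.Membership.DecPropositional ℕ._≟_ using () renaming (_∈?_ to _∈ˡ?_; _∉?_ to _∉ˡ?_)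
open import Data.Product using (Σ; ∃-syntax; _×_; _,_; proj₁; proj₂)
open import Data.Sum as Sum using (_⊎_; inj₁; inj₂; [_,_]; [_,_]′)
open import Data.Vec as Vec using (Vec; []; _∷_; _++_)
open import Data.Vec.Properties using (lookup-++ˡ; lookup-++ʳ; []=⇒lookup; lookup⇒[]=)
open import Function using (_∘_; id; Equivalence)
open import Relation.Binary.PropositionalEquality using (_≡_; _≢_; refl; sym; trans; cong; cong₂; subst)
open import Relation.Nullary using (¬_; Dec; yes; no; does; contradiction; ¬?; _×-dec_; _⊎-dec_; _→-dec_)
import Relation.Nullary.Decidable as Dec

-- Branching search for small hitting sets

Clause : Set
Clause = List ℕ

Hit Miss : List ℕ → Clause → Set
Hit  Q c = ∃[ x ] x ∈ˡ c × x ∈ˡ Q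
Miss Q c = ∃[ x ] x ∈ˡ c × x ∉ˡ Q

_without_ : List ℕ → ℕ → List ℕ
xs without p = filter (λ x → ¬? (x ℕ.≟ p)) xs

avoiding : ℕ → List Clause → List Clause
avoiding p = filter (p ∉ˡ?_)

degree : ℕ → List Clause → ℕ
degree p cs = length (filter (p ∈ˡ?_) cs)

MaxDegree3 : List ℕ → List Clause → Set
MaxDegree3 Q cs = ∀ {p} → p ∈ˡ Q → degree p cs ≤ 3

-- `true` certifies that more than `n` points are needed to hit every clause of `pos` while missing
-- a point of each clause of `neg`, if chosen points have degree at most three. A branch closes when
-- some `neg` clause has had all its points chosen, or when `pos` has more clauses than `n` such
-- points can hit.
refutes : ℕ → List Clause → List Clause → Bool
branch  : ℕ → List Clause → List Clause → Bool

refutes n pos neg = any null neg ∨ ((3 * n <ᵇ length pos) ∨ branch n pos neg)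

-- `false` means inconclusive. With budget zero and a clause left, the counting test of `refutes`
-- has already answered `true`.
branch n       []        neg = false
branch zero    (c ∷ pos) neg = false
branch (suc n) (c ∷ pos) neg =
  all (λ p → refutes n (avoiding p pos) (map (_without p) neg)) c

without⊆ : ∀ {p q} Q → q ∈ˡ Q without p → q ∈ˡ Q
without⊆ Q = proj₁ ∘ ∈-filter⁻ _

length-without : ∀ {p} Q → p ∈ˡ Q → length (Q without p) < length Q
length-without Q p∈Q = filter-notAll _ Q (Any.map (λ { refl ≢p → ≢p refl }) p∈Q)

length-avoiding : ∀ p cs → length cs ≤ degree p cs + length (avoiding p cs)
length-avoiding p []       = z≤n
length-avoiding p (c ∷ cs) with p ∈ˡ? c
... | yes _ = s≤s (length-avoiding p cs)
... | no  _ = ℕ.≤-trans (s≤s (length-avoiding p cs)) (ℕ.≤-reflexive (sym (ℕ.+-suc _ _)))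

degree-avoiding : ∀ q p cs → degree q (avoiding p cs) ≤ degree q cs
degree-avoiding q p []       = z≤n
degree-avoiding q p (c ∷ cs) with p ∈ˡ? c
... | yes _ with q ∈ˡ? c
...   | yes _ = ℕ.m≤n⇒m≤1+n (degree-avoiding q p cs)
...   | no  _ = degree-avoiding q p cs
degree-avoiding q p (c ∷ cs) | no _ with q ∈ˡ? c
...   | yes _ = s≤s (degree-avoiding q p cs)
...   | no  _ = degree-avoiding q p cs

degree-tail : ∀ q c cs → degree q cs ≤ degree q (c ∷ cs)
degree-tail q c cs with q ∈ˡ? c
... | yes _ = ℕ.n≤1+n _
... | no  _ = ℕ.≤-refl

hit-avoiding : ∀ p {Q cs} → All (Hit Q) cs → All (Hit (Q without p)) (avoiding p cs)
hit-avoiding p {Q} {cs} hits =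
  All.zipWith (λ { (p∉c , x , x∈c , x∈Q) →
    x , x∈c , ∈-filter⁺ _ x∈Q (λ { refl → p∉c x∈c }) })
    (All.all-filter (p ∉ˡ?_) cs , All.filter⁺ (p ∉ˡ?_) hits)

miss-without : ∀ {p Q c} → p ∈ˡ Q → Miss Q c → Miss (Q without p) (c without p)
miss-without p∈Q (x , x∈c , x∉Q) =
  x , ∈-filter⁺ _ x∈c (λ { refl → x∉Q p∈Q }) , x∉Q ∘ proj₁ ∘ ∈-filter⁻ _

-- A point of `Q` in the first clause accounts for at most three clauses; the others are hit by `Q`
-- without that point.
length≤3*size : ∀ n Q cs → length Q ≤ n → MaxDegree3 Q cs → All (Hit Q) cs →
                length cs ≤ 3 * n
length≤3*size n       Q []       _ _ _ = z≤n
length≤3*size zero    [] (c ∷ cs) _ _ ((_ , _ , ()) ∷ _)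
length≤3*size (suc n) Q (c ∷ cs) Q≤ deg hits@((p , p∈c , p∈Q) ∷ _) = begin
  length (c ∷ cs)                                       ≤⟨ length-avoiding p (c ∷ cs) ⟩
  degree p (c ∷ cs) + length (avoiding p (c ∷ cs))      ≤⟨ ℕ.+-mono-≤ (deg p∈Q) rest ⟩
  3 + 3 * n                                             ≡⟨ ℕ.*-suc 3 n ⟨
  3 * suc n                                             ∎
  where
  open ℕ.≤-Reasoning
  rest : length (avoiding p (c ∷ cs)) ≤ 3 * n
  rest = length≤3*size n (Q without p) _
    (ℕ.≤-pred (ℕ.≤-trans (length-without Q p∈Q) Q≤))
    (λ q∈ → ℕ.≤-trans (degree-avoiding _ p (c ∷ cs)) (deg (without⊆ Q q∈)))
    (hit-avoiding p hits)

-- Some `p` in `Q` hits the first clause, and `all` covers the branch of that `p`. There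
-- `Q without p` is shorter and inherits the hypotheses: clauses avoiding `p` are hit by other
-- points, and a point missed by `Q` differs from `p`, so it survives the deletion of `p`.
refutes-sound : ∀ n pos neg → T (refutes n pos neg) → ∀ Q → MaxDegree3 Q pos →
                All (Hit Q) pos → All (Miss Q) neg → n < length Q
branch-sound  : ∀ n pos neg → T (branch n pos neg) → ∀ Q → MaxDegree3 Q pos →
                All (Hit Q) pos → All (Miss Q) neg → n < length Q

refutes-sound n pos neg t Q deg hits misses
  with Equivalence.to (T-∨ {any null neg}) t
... | inj₁ e with find (any⁻ null neg e)
...   | [] , c∈ , _ with () ← proj₁ (proj₂ (All.lookup misses c∈))
refutes-sound n pos neg t Q deg hits misses | inj₂ u
  with Equivalence.to (T-∨ {3 * n <ᵇ length pos}) u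
... | inj₁ l = ℕ.≰⇒> λ Q≤n →
        ℕ.<⇒≱ (ℕ.<ᵇ⇒< _ _ l) (length≤3*size n Q pos Q≤n deg hits)
... | inj₂ b = branch-sound n pos neg b Q deg hits misses

branch-sound (suc n) (c ∷ pos) neg t Q deg ((p , p∈c , p∈Q) ∷ hits) misses =
  ℕ.≤-trans (s≤s (refutes-sound n _ _ (All.lookup (All.all⁺ _ c t) p∈c)
      (Q without p)
      (λ q∈ → ℕ.≤-trans (degree-avoiding _ p pos)
                (ℕ.≤-trans (degree-tail _ c pos) (deg (without⊆ Q q∈))))
      (hit-avoiding p hits)
      (All.map⁺ (All.map (miss-without p∈Q) misses))))
    (length-without Q p∈Q)

-- Frames and splicing

-- The incidence graph of a v₃ is cubic and bipartite, hence a union of three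
-- perfect matchings: for each i, b ↦ line b i is a bijection from blocks to points.
record Frame (P : Set) : Set where
  field
    line        : P → Fin 3 → P
    pencil      : P → Fin 3 → P
    line-pencil : ∀ p i → line (pencil p i) i ≡ p
    pencil-line : ∀ b i → pencil (line b i) i ≡ b
    distinct    : ∀ b {i j} → line b i ≡ line b j → i ≡ j
    linear      : ∀ b b′ {i j k l} → i ≢ j →
                  line b i ≡ line b′ k → line b j ≡ line b′ l → b ≡ b′

open Frame

config : ∀ {v} → Frame (Fin v) → Config v
config F = record
  { block          = line F
  ; block-distinct = λ b i j → distinct F b
  ; through        = pencil F
  ; through-inj    = λ p k l eq → distinct F (pencil F p k)
      (trans (line-pencil F p k) (sym (trans (cong (λ b → line F b l) eq) (line-pencil F p l))))
  ; through-∈      = λ p k → k , line-pencil F p k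
  ; through-all    = λ { p b (i , refl) → i , pencil-line F b i }
  ; pair-unique    = λ { p q p≢q b b′ (i , bi≡p) (j , bj≡q) (k , b′k≡p) (l , b′l≡q) →
      linear F b b′ {i} {j} {k} {l}
        (λ { refl → p≢q (trans (sym bi≡p) bj≡q) })
        (trans bi≡p (sym b′k≡p)) (trans bj≡q (sym b′l≡q)) }
  }

relabel : ∀ m n → Frame (Fin m ⊎ Fin n) → Frame (Fin (m + n))
relabel m n F = record
  { line        = λ b i → join m n (line F (splitAt m b) i)
  ; pencil      = λ p i → join m n (pencil F (splitAt m p) i)
  ; line-pencil = λ p i → trans
      (cong (λ b → join m n (line F b i)) (splitAt-join m n _))
      (trans (cong (join m n) (line-pencil F _ i)) (join-splitAt m n p))
  ; pencil-line = λ b i → trans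
      (cong (λ p → join m n (pencil F p i)) (splitAt-join m n _))
      (trans (cong (join m n) (pencil-line F _ i)) (join-splitAt m n b))
  ; distinct    = λ b eq → distinct F _ (join-injective eq)
  ; linear      = λ b b′ i≢j eq eq′ → trans (sym (join-splitAt m n b))
      (trans (cong (join m n) (linear F _ _ i≢j (join-injective eq) (join-injective eq′)))
        (join-splitAt m n b′))
  }
  where
  join-injective : ∀ {s t} → join m n s ≡ join m n t → s ≡ t
  join-injective {s} {t} eq =
    trans (sym (splitAt-join m n s)) (trans (cong (splitAt m) eq) (splitAt-join m n t))

module Splice {m n} (H : Frame (Fin (suc m))) (C : Frame (Fin (suc n))) where

  Point : Set
  Point = Fin (suc m) ⊎ Fin (suc n)

  line′ : Point → Fin 3 → Point
  line′ (inj₁ zero)    zero    = inj₂ (line C zero zero)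
  line′ (inj₁ zero)    (suc i) = inj₁ (line H zero (suc i))
  line′ (inj₁ (suc b)) i       = inj₁ (line H (suc b) i)
  line′ (inj₂ zero)    zero    = inj₁ (line H zero zero)
  line′ (inj₂ zero)    (suc i) = inj₂ (line C zero (suc i))
  line′ (inj₂ (suc b)) i       = inj₂ (line C (suc b) i)

  -- Only the flag point changes its slot-zero block: the flag point of `H` now lies in block zero
  -- of `C`.
  crossˡ : Fin (suc m) → Point
  crossˡ zero    = inj₂ zero
  crossˡ (suc b) = inj₁ (suc b)

  crossʳ : Fin (suc n) → Point
  crossʳ zero    = inj₁ zero
  crossʳ (suc b) = inj₂ (suc b)

  pencil′ : Point → Fin 3 → Point
  pencil′ (inj₁ p) zero    = crossˡ (pencil H p zero)
  pencil′ (inj₁ p) (suc i) = inj₁ (pencil H p (suc i))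
  pencil′ (inj₂ p) zero    = crossʳ (pencil C p zero)
  pencil′ (inj₂ p) (suc i) = inj₂ (pencil C p (suc i))

  line-crossˡ : ∀ b → line′ (crossˡ b) zero ≡ inj₁ (line H b zero)
  line-crossˡ zero    = refl
  line-crossˡ (suc b) = refl

  line-crossʳ : ∀ b → line′ (crossʳ b) zero ≡ inj₂ (line C b zero)
  line-crossʳ zero    = refl
  line-crossʳ (suc b) = refl

  line-sucˡ : ∀ b i → line′ (inj₁ b) (suc i) ≡ inj₁ (line H b (suc i))
  line-sucˡ zero    i = refl
  line-sucˡ (suc b) i = refl

  line-sucʳ : ∀ b i → line′ (inj₂ b) (suc i) ≡ inj₂ (line C b (suc i))
  line-sucʳ zero    i = refl
  line-sucʳ (suc b) i = refl

  line-pencil′ : ∀ p i → line′ (pencil′ p i) i ≡ p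
  line-pencil′ (inj₁ p) zero    = trans (line-crossˡ _) (cong inj₁ (line-pencil H p zero))
  line-pencil′ (inj₁ p) (suc i) = trans (line-sucˡ _ i) (cong inj₁ (line-pencil H p (suc i)))
  line-pencil′ (inj₂ p) zero    = trans (line-crossʳ _) (cong inj₂ (line-pencil C p zero))
  line-pencil′ (inj₂ p) (suc i) = trans (line-sucʳ _ i) (cong inj₂ (line-pencil C p (suc i)))

  pencil-line′ : ∀ b i → pencil′ (line′ b i) i ≡ b
  pencil-line′ (inj₁ zero)    zero    = cong crossʳ (pencil-line C zero zero)
  pencil-line′ (inj₁ zero)    (suc i) = cong inj₁ (pencil-line H zero (suc i))
  pencil-line′ (inj₁ (suc b)) zero    = cong crossˡ (pencil-line H (suc b) zero)
  pencil-line′ (inj₁ (suc b)) (suc i) = cong inj₁ (pencil-line H (suc b) (suc i))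
  pencil-line′ (inj₂ zero)    zero    = cong crossˡ (pencil-line H zero zero)
  pencil-line′ (inj₂ zero)    (suc i) = cong inj₂ (pencil-line C zero (suc i))
  pencil-line′ (inj₂ (suc b)) zero    = cong crossʳ (pencil-line C (suc b) zero)
  pencil-line′ (inj₂ (suc b)) (suc i) = cong inj₂ (pencil-line C (suc b) (suc i))

  -- Inversion of `line′`: a point on the block's own side is the old point of that slot, and a
  -- foreign point occurs only in slot zero of block zero.
  stayˡ : ∀ b i {x} → line′ (inj₁ b) i ≡ inj₁ x → line H b i ≡ x
  stayˡ zero    (suc i) refl = refl
  stayˡ (suc b) i       refl = refl

  leaveˡ : ∀ b i {y} → line′ (inj₁ b) i ≡ inj₂ y → b ≡ zero × i ≡ zero
  leaveˡ zero zero _ = refl , refl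

  stayʳ : ∀ b i {y} → line′ (inj₂ b) i ≡ inj₂ y → line C b i ≡ y
  stayʳ zero    (suc i) refl = refl
  stayʳ (suc b) i       refl = refl

  leaveʳ : ∀ b i {x} → line′ (inj₂ b) i ≡ inj₁ x → b ≡ zero × i ≡ zero × line H zero zero ≡ x
  leaveʳ zero zero refl = refl , refl , refl

  distinct′ : ∀ b {i j} → line′ b i ≡ line′ b j → i ≡ j
  distinct′ (inj₁ b) {i} {j} eq with line′ (inj₁ b) j in eqj
  ... | inj₁ x = distinct H b (trans (stayˡ b i eq) (sym (stayˡ b j eqj)))
  ... | inj₂ y = trans (proj₂ (leaveˡ b i eq)) (sym (proj₂ (leaveˡ b j eqj)))
  distinct′ (inj₂ b) {i} {j} eq with line′ (inj₂ b) j in eqj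
  ... | inj₂ y = distinct C b (trans (stayʳ b i eq) (sym (stayʳ b j eqj)))
  ... | inj₁ x = trans (proj₁ (proj₂ (leaveʳ b i eq))) (sym (proj₁ (proj₂ (leaveʳ b j eqj))))

  -- Blocks of H and of C meet only through slot zero of their blocks zero, so two
  -- common points would use slot zero of b twice or the flag point of H twice.
  cross-linear : ∀ b b′ {i j k l} → i ≢ j →
                 line′ (inj₁ b) i ≡ line′ (inj₂ b′) k →
                 ¬ line′ (inj₁ b) j ≡ line′ (inj₂ b′) l
  cross-linear b b′ {i} {j} {k} {l} i≢j eq eq′
    with line′ (inj₂ b′) k in eqk | line′ (inj₂ b′) l in eql
  ... | inj₂ _ | inj₂ _ =
    i≢j (trans (proj₂ (leaveˡ b i eq)) (sym (proj₂ (leaveˡ b j eq′))))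
  ... | inj₁ _ | inj₁ _ = i≢j (distinct H b
    (trans (stayˡ b i eq) (trans (sym (proj₂ (proj₂ (leaveʳ b′ k eqk))))
      (trans (proj₂ (proj₂ (leaveʳ b′ l eql))) (sym (stayˡ b j eq′))))))
  ... | inj₂ _ | inj₁ _ with leaveˡ b i eq
  ...   | refl , refl = i≢j (distinct H zero
    (trans (proj₂ (proj₂ (leaveʳ b′ l eql))) (sym (stayˡ zero j eq′))))
  cross-linear b b′ {i} {j} {k} {l} i≢j eq eq′ | inj₁ _ | inj₂ _ with leaveˡ b j eq′
  ...   | refl , refl = i≢j (distinct H zero
    (trans (stayˡ zero i eq) (sym (proj₂ (proj₂ (leaveʳ b′ k eqk))))))

  -- For blocks of one side, two common points on that side reduce to the old frame, while a foreign
  -- common point makes both blocks block zero. Blocks of different sides never share two points.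
  linear′ : ∀ b b′ {i j k l} → i ≢ j →
            line′ b i ≡ line′ b′ k → line′ b j ≡ line′ b′ l → b ≡ b′
  linear′ (inj₁ b) (inj₂ b′) i≢j eq eq′ = contradiction eq′ (cross-linear b b′ i≢j eq)
  linear′ (inj₂ b) (inj₁ b′) {i} {j} {k} {l} i≢j eq eq′ =
    contradiction (sym eq′) (cross-linear b′ b k≢l (sym eq))
    where
    k≢l : k ≢ l
    k≢l refl = i≢j (distinct′ (inj₂ b) (trans eq (sym eq′)))
  linear′ (inj₁ b) (inj₁ b′) {i} {j} {k} {l} i≢j eq eq′
    with line′ (inj₁ b′) k in eqk | line′ (inj₁ b′) l in eql
  ... | inj₁ _ | inj₁ _ = cong inj₁ (linear H b b′ i≢j
    (trans (stayˡ b i eq) (sym (stayˡ b′ k eqk))) (trans (stayˡ b j eq′) (sym (stayˡ b′ l eql))))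
  ... | inj₂ _ | _      = cong inj₁ (trans (proj₁ (leaveˡ b i eq)) (sym (proj₁ (leaveˡ b′ k eqk))))
  ... | inj₁ _ | inj₂ _ = cong inj₁ (trans (proj₁ (leaveˡ b j eq′)) (sym (proj₁ (leaveˡ b′ l eql))))
  linear′ (inj₂ b) (inj₂ b′) {i} {j} {k} {l} i≢j eq eq′
    with line′ (inj₂ b′) k in eqk | line′ (inj₂ b′) l in eql
  ... | inj₂ _ | inj₂ _ = cong inj₂ (linear C b b′ i≢j
    (trans (stayʳ b i eq) (sym (stayʳ b′ k eqk))) (trans (stayʳ b j eq′) (sym (stayʳ b′ l eql))))
  ... | inj₁ _ | _      = cong inj₂ (trans (proj₁ (leaveʳ b i eq)) (sym (proj₁ (leaveʳ b′ k eqk))))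
  ... | inj₂ _ | inj₁ _ = cong inj₂ (trans (proj₁ (leaveʳ b j eq′)) (sym (proj₁ (leaveʳ b′ l eql))))

  frame′ : Frame Point
  frame′ = record
    { line        = line′
    ; pencil      = pencil′
    ; line-pencil = line-pencil′
    ; pencil-line = pencil-line′
    ; distinct    = distinct′
    ; linear      = linear′
    }

  spliced : Frame (Fin (suc m + suc n))
  spliced = relabel (suc m) (suc n) frame′

-- Blocking sets under splicing

module _ {m n} (Q₁ : Subset m) (Q₂ : Subset n) where

  In : Fin m ⊎ Fin n → Set
  In = [ _∈ Q₁ , _∈ Q₂ ]′

  ∈-join⁺ : ∀ s → In s → join m n s ∈ Q₁ ++ Q₂
  ∈-join⁺ (inj₁ x) x∈ = lookup⇒[]= _ _ (trans (lookup-++ˡ Q₁ Q₂ x) ([]=⇒lookup x∈))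
  ∈-join⁺ (inj₂ y) y∈ = lookup⇒[]= _ _ (trans (lookup-++ʳ Q₁ Q₂ y) ([]=⇒lookup y∈))

  ∈-join⁻ : ∀ s → join m n s ∈ Q₁ ++ Q₂ → In s
  ∈-join⁻ (inj₁ x) x∈ = lookup⇒[]= _ _ (trans (sym (lookup-++ˡ Q₁ Q₂ x)) ([]=⇒lookup x∈))
  ∈-join⁻ (inj₂ y) y∈ = lookup⇒[]= _ _ (trans (sym (lookup-++ʳ Q₁ Q₂ y)) ([]=⇒lookup y∈))

∣++∣ : ∀ {m n} (Q₁ : Subset m) (Q₂ : Subset n) → ∣ Q₁ ++ Q₂ ∣ ≡ ∣ Q₁ ∣ + ∣ Q₂ ∣
∣++∣ []             Q₂ = refl
∣++∣ (inside  ∷ Q₁) Q₂ = cong suc (∣++∣ Q₁ Q₂)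
∣++∣ (outside ∷ Q₁) Q₂ = ∣++∣ Q₁ Q₂

module _ {P : Set} (F : Frame P) (I : P → Set) where

  Meets Leaves Blocked Uniform : P → Set
  Meets   b = ∃[ i ] I (line F b i)
  Leaves  b = ∃[ i ] ¬ I (line F b i)
  Blocked b = Meets b × Leaves b
  Uniform b = (∀ i → I (line F b i)) ⊎ (∀ i → ¬ I (line F b i))

-- The flag of a frame is the incidence of block zero with line zero zero.
-- Meets⁻ and Leaves⁻ ignore it, and Connected⁻ ignores block zero altogether.
module _ {n} (F : Frame (Fin (suc n))) (Q : Subset (suc n)) where

  Meets⁻ Leaves⁻ : Set
  Meets⁻  = ∃[ i ] line F zero (suc i) ∈ Q
  Leaves⁻ = ∃[ i ] line F zero (suc i) ∉ Q

Connected⁻ : ∀ {n} → Frame (Fin (suc n)) → Set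
Connected⁻ F = ∀ S → (∀ b → Uniform F (_∈ S) (suc b)) → (∀ p → p ∉ S) ⊎ (∀ p → p ∈ S)

-- `Connected⁻` assumes uniformity of fewer blocks than `Connected`, hence is stronger; it is the
-- form that survives cutting the flag.
record BlockingNumber {n} (F : Frame (Fin (suc n))) (k : ℕ) : Set where
  field
    connected : Connected⁻ F
    least     : ∀ Q → (∀ b → Blocked F (_∈ Q) b) → k ≤ ∣ Q ∣
    Q*        : Subset (suc n)
    Q*-blocks : ∀ b → Blocked F (_∈ Q*) b
    Q*-size   : ∣ Q* ∣ ≡ k

-- In a splice a foreign point takes the place of the flag point in block zero;
-- least₀ and least₁ are the bounds with that point outside, respectively inside,
-- the blocking set.
record Socket (n k : ℕ) : Set where
  field
    frame  : Frame (Fin (suc n))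
    number : BlockingNumber frame k
  open BlockingNumber number public
  field
    least₀ : ∀ Q → (∀ b → Blocked frame (_∈ Q) (suc b)) → Meets⁻ frame Q → k ≤ ∣ Q ∣
    least₁ : ∀ Q → (∀ b → Blocked frame (_∈ Q) (suc b)) → Leaves⁻ frame Q → k ≤ suc ∣ Q ∣
    flag∉  : line frame zero zero ∉ Q*

-- Block zero loses its flag point in a splice, so both bounds rest on the other blocks. The extra
-- point in `least₁` pays for the one that `least₁` of a `Socket` concedes.
record Plug (m h : ℕ) : Set where
  field
    frame     : Frame (Fin (suc m))
    connected : Connected⁻ frame
    least     : ∀ Q → (∀ b → Meets frame (_∈ Q) (suc b)) → h ≤ ∣ Q ∣
    least₁    : ∀ Q → (∀ b → Meets frame (_∈ Q) (suc b)) →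
                line frame zero zero ∈ Q → suc h ≤ ∣ Q ∣
    Q*        : Subset (suc m)
    Q*-blocks : ∀ b → Blocked frame (_∈ Q*) b
    Q*-size   : ∣ Q* ∣ ≡ h
    flag∉     : line frame zero zero ∉ Q*

module Insertion {m h n k} (plug : Plug m h) (socket : Socket n k) where
  private
    module H = Plug plug
    module C = Socket socket
  open Splice H.frame C.frame

  ι : Point → Fin (suc m + suc n)
  ι = join (suc m) (suc n)

  line-ι : ∀ b i → line spliced (ι b) i ≡ ι (line′ b i)
  line-ι b i = cong (λ s → ι (line′ s i)) (splitAt-join (suc m) (suc n) b)

  module _ (Q₁ : Subset (suc m)) (Q₂ : Subset (suc n)) where

    In⁺ : ∀ b i → In Q₁ Q₂ (line′ b i) → line spliced (ι b) i ∈ Q₁ ++ Q₂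
    In⁺ b i = subst (_∈ Q₁ ++ Q₂) (sym (line-ι b i)) ∘ ∈-join⁺ Q₁ Q₂ (line′ b i)

    In⁻ : ∀ b i → line spliced (ι b) i ∈ Q₁ ++ Q₂ → In Q₁ Q₂ (line′ b i)
    In⁻ b i = ∈-join⁻ Q₁ Q₂ (line′ b i) ∘ subst (_∈ Q₁ ++ Q₂) (line-ι b i)

    blocked⁺ : ∀ b → Blocked frame′ (In Q₁ Q₂) b → Blocked spliced (_∈ Q₁ ++ Q₂) (ι b)
    blocked⁺ b ((i , i∈) , (j , j∉)) = (i , In⁺ b i i∈) , (j , j∉ ∘ In⁻ b j)

    blocked⁻ : ∀ b → Blocked spliced (_∈ Q₁ ++ Q₂) (ι b) → Blocked frame′ (In Q₁ Q₂) b
    blocked⁻ b ((i , i∈) , (j , j∉)) = (i , In⁻ b i i∈) , (j , j∉ ∘ In⁺ b j)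

    uniform⁻ : ∀ b → Uniform spliced (_∈ Q₁ ++ Q₂) (ι b) → Uniform frame′ (In Q₁ Q₂) b
    uniform⁻ b = Sum.map (λ u i → In⁻ b i (u i)) (λ u i → u i ∘ In⁺ b i)

    -- Block zero of `C` holds the flag point of `H`. If that point is in `Q₁`, the block must leave
    -- `Q₂` at one of its own points: `C` may save one point and `H` spends one more. Otherwise it
    -- must meet `Q₂` at its own points, and neither side saves.
    least-++ : (∀ b → Blocked spliced (_∈ Q₁ ++ Q₂) (suc b)) → h + k ≤ ∣ Q₁ ∣ + ∣ Q₂ ∣
    -- The successor of `m ↑ʳ zero` is the index of block zero of `C`; index zero of the splice is
    -- block zero of `H`.
    least-++ blocks with line H.frame zero zero ∈? Q₁ | blocked⁻ (inj₂ zero) (blocks (m ↑ʳ zero))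
    ... | yes q∈ | _ , zero  , q∉ = contradiction q∈ q∉
    ... | yes q∈ | _ , suc j , j∉ = begin
      h + k            ≤⟨ ℕ.+-monoʳ-≤ h (C.least₁ Q₂ C-blocks (j , j∉)) ⟩
      h + suc ∣ Q₂ ∣   ≡⟨ ℕ.+-suc h _ ⟩
      suc h + ∣ Q₂ ∣   ≤⟨ ℕ.+-monoˡ-≤ _ (H.least₁ Q₁ H-meets q∈) ⟩
      ∣ Q₁ ∣ + ∣ Q₂ ∣  ∎
      where
      open ℕ.≤-Reasoning
      H-meets : ∀ b → Meets H.frame (_∈ Q₁) (suc b)
      H-meets b = proj₁ (blocked⁻ (inj₁ (suc b)) (blocks (b ↑ˡ suc n)))
      C-blocks : ∀ b → Blocked C.frame (_∈ Q₂) (suc b)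
      C-blocks b = blocked⁻ (inj₂ (suc b)) (blocks (m ↑ʳ suc b))
    ... | no q∉ | (zero  , q∈) , _ = contradiction q∈ q∉
    ... | no q∉ | (suc i , i∈) , _ =
      ℕ.+-mono-≤ (H.least Q₁ λ b → proj₁ (blocked⁻ (inj₁ (suc b)) (blocks (b ↑ˡ suc n))))
        (C.least₀ Q₂ (λ b → blocked⁻ (inj₂ (suc b)) (blocks (m ↑ʳ suc b))) (i , i∈))

    -- The uncut blocks make each side all in or all out. Block zero of `C` contains points of both
    -- sides, so the two sides agree.
    connected-++ : (∀ b → Uniform spliced (_∈ Q₁ ++ Q₂) (suc b)) →
                   (∀ s → ¬ In Q₁ Q₂ s) ⊎ (∀ s → In Q₁ Q₂ s)
    connected-++ u
      with H.connected Q₁ (λ b → uniform⁻ (inj₁ (suc b)) (u (b ↑ˡ suc n)))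
         | C.connected Q₂ (λ b → uniform⁻ (inj₂ (suc b)) (u (m ↑ʳ suc b)))
         | uniform⁻ (inj₂ zero) (u (m ↑ʳ zero))
    ... | inj₁ ∉₁ | inj₁ ∉₂ | _      = inj₁ [ ∉₁ , ∉₂ ]
    ... | inj₂ ∈₁ | inj₂ ∈₂ | _      = inj₂ [ ∈₁ , ∈₂ ]
    ... | inj₁ ∉₁ | inj₂ ∈₂ | inj₁ w = contradiction (w zero) (∉₁ _)
    ... | inj₁ ∉₁ | inj₂ ∈₂ | inj₂ w = contradiction (∈₂ _) (w (suc zero))
    ... | inj₂ ∈₁ | inj₁ ∉₂ | inj₁ w = contradiction (w (suc zero)) (∉₂ _)
    ... | inj₂ ∈₁ | inj₁ ∉₂ | inj₂ w = contradiction (∈₁ _) (w zero)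

  least⁻ : ∀ Q → (∀ b → Blocked spliced (_∈ Q) (suc b)) → h + k ≤ ∣ Q ∣
  least⁻ Q blocks with Vec.splitAt (suc m) Q
  ... | Q₁ , Q₂ , refl = subst (h + k ≤_) (sym (∣++∣ Q₁ Q₂)) (least-++ Q₁ Q₂ blocks)

  connected′ : Connected⁻ spliced
  connected′ S u with Vec.splitAt (suc m) S
  ... | S₁ , S₂ , refl = Sum.map
    (λ ∉S p p∈ → ∉S (splitAt (suc m) p) (∈-join⁻ S₁ S₂ (splitAt (suc m) p) (subst (_∈ S₁ ++ S₂) (sym (join-splitAt (suc m) _ p)) p∈)))
    (λ ∈S p → subst (_∈ S₁ ++ S₂) (join-splitAt (suc m) _ p) 
                (∈-join⁺ S₁ S₂ (splitAt (suc m) p) (∈S (splitAt (suc m) p))))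
    (connected-++ S₁ S₂ u)

  -- Both flag points are outside, so each block zero is met away from slot zero; it stays met after
  -- the exchange and leaves the set at the foreign flag point.
  union-blocks : ∀ b → Blocked frame′ (In H.Q* C.Q*) b
  union-blocks (inj₁ (suc b)) = H.Q*-blocks (suc b)
  union-blocks (inj₂ (suc b)) = C.Q*-blocks (suc b)
  union-blocks (inj₁ zero) with H.Q*-blocks zero
  ... | (zero  , i∈) , _ = contradiction i∈ H.flag∉
  ... | (suc i , i∈) , _ = (suc i , i∈) , (zero , C.flag∉)
  union-blocks (inj₂ zero) with C.Q*-blocks zero
  ... | (zero  , i∈) , _ = contradiction i∈ C.flag∉
  ... | (suc i , i∈) , _ = (suc i , i∈) , (zero , H.flag∉)

  -- The new flag is block zero of `H` with the flag point of `C`. As `least⁻` constrains only the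
  -- other blocks, it supplies all three bounds, and splicing can be iterated.
  inserted : Socket (m + suc n) (h + k)
  inserted = record
    { frame  = spliced
    ; number = record
      { connected = connected′
      ; least     = λ Q blocks → least⁻ Q (blocks ∘ suc)
      ; Q*        = H.Q* ++ C.Q*
      ; Q*-blocks = λ b → subst (Blocked spliced (_∈ H.Q* ++ C.Q*)) (join-splitAt (suc m) _ b)
                      (blocked⁺ H.Q* C.Q* (splitAt (suc m) b) (union-blocks (splitAt (suc m) b)))
      ; Q*-size   = trans (∣++∣ H.Q* C.Q*) (cong₂ _+_ H.Q*-size C.Q*-size)
      }
    ; least₀ = λ Q blocks _ → least⁻ Q blocks
    ; least₁ = λ Q blocks _ → ℕ.m≤n⇒m≤1+n (least⁻ Q blocks)
    ; flag∉  = C.flag∉ ∘ In⁻ H.Q* C.Q* (inj₁ zero) zero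
    }

-- Base configurations

holds : ∀ {A : Set} (a? : Dec A) → does a? ≡ true → A
holds (yes a) _ = a

members : ∀ {v} → Subset v → List ℕ
members []            = []
members (inside  ∷ Q) = 0 ∷ map suc (members Q)
members (outside ∷ Q) = map suc (members Q)

length-members : ∀ {v} (Q : Subset v) → length (members Q) ≡ ∣ Q ∣
length-members []            = refl
length-members (inside  ∷ Q) = cong suc (trans (length-map suc (members Q)) (length-members Q))
length-members (outside ∷ Q) = trans (length-map suc (members Q)) (length-members Q)

∈-members⁺ : ∀ {v} {Q : Subset v} {x} → x ∈ Q → toℕ x ∈ˡ members Q
∈-members⁺                      Vec.here       = here refl
∈-members⁺ {Q = inside  ∷ Q}    (Vec.there x∈) = there (∈-map⁺ suc (∈-members⁺ x∈))
∈-members⁺ {Q = outside ∷ Q}    (Vec.there x∈) = ∈-map⁺ suc (∈-members⁺ x∈)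

∈-members⁻ : ∀ {v} (Q : Subset v) {y} → y ∈ˡ members Q → ∃[ x ] x ∈ Q × toℕ x ≡ y
∈-members⁻ (inside  ∷ Q) (here refl) = zero , Vec.here , refl
∈-members⁻ (inside  ∷ Q) (there y∈) with ∈-map⁻ suc y∈
... | _ , z∈ , refl with ∈-members⁻ Q z∈
...   | x , x∈ , refl = suc x , Vec.there x∈ , refl
∈-members⁻ (outside ∷ Q) y∈ with ∈-map⁻ suc y∈
... | _ , z∈ , refl with ∈-members⁻ Q z∈
...   | x , x∈ , refl = suc x , Vec.there x∈ , refl

∉-members : ∀ {v} {Q : Subset v} {x} → x ∉ Q → toℕ x ∉ˡ members Q
∉-members {Q = Q} x∉ x∈ with ∈-members⁻ Q x∈
... | y , y∈ , eq = x∉ (subst (_∈ Q) (toℕ-injective eq) y∈)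

-- Checking the degree of every point once yields `MaxDegree3` for every candidate set.
certifies : ℕ → ℕ → List Clause → List Clause → Bool
certifies v n pos neg =
  does (all? {v} λ x → degree (toℕ x) pos ≤? 3) ∧ refutes n pos neg

certifies-sound : ∀ {v} n {pos neg} → certifies v n pos neg ≡ true → (Q : Subset v) →
                  All (Hit (members Q)) pos → All (Miss (members Q)) neg → n < ∣ Q ∣
certifies-sound {v} n {pos} {neg} ok Q hits misses =
  subst (n <_) (length-members Q)
    (refutes-sound n pos neg (proj₂ both) (members Q) degrees hits misses)
  where
  degree? = all? {v} λ x → degree (toℕ x) pos ≤? 3
  both = Equivalence.to (T-∧ {does degree?}) (Equivalence.from T-≡ ok)
  degrees : MaxDegree3 (members Q) pos
  degrees p∈ with ∈-members⁻ Q p∈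
  ... | x , _ , refl = holds degree? (Equivalence.to T-≡ (proj₁ both)) x

-- Row b lists the two points of block b other than b itself.
Table : ℕ → Set
Table n = Vec (ℕ × ℕ) (suc n)

module _ {n} (t : Table n) where

  row : Fin (suc n) → Fin 3 → Fin (suc n)
  row b zero             = b
  row b (suc zero)       = proj₁ (Vec.lookup t b) mod suc n
  row b (suc (suc zero)) = proj₂ (Vec.lookup t b) mod suc n

  column : Fin (suc n) → Fin 3 → Fin (suc n)
  column p i with any? (λ b → row b i ≟ p)
  ... | yes (b , _) = b
  -- A default that `row-column` exposes: if no block has `p` in slot `i`, block zero does not
  -- either.
  ... | no  _       = zero

  -- `linear` compares `b` only with the blocks through its own points, not with all blocks.
  -- `descending` gives connectedness: block `suc b` contains the point `suc b` and a smaller one.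
  record WellFormed : Set where
    constructor wellFormed
    field
      row-column : ∀ p i → row (column p i) i ≡ p
      column-row : ∀ b i → column (row b i) i ≡ b
      distinct   : ∀ b i j → row b i ≡ row b j → i ≡ j
      linear     : ∀ b i k → column (row b i) k ≡ b ⊎
                   (∀ j l → row b j ≡ row (column (row b i) k) l → i ≡ j)
      descending : ∀ b → ∃[ i ] toℕ (row (suc b) i) < toℕ (suc b)

  wellFormed? : Dec WellFormed
  wellFormed? = Dec.map′
    (λ (a , b , c , d , e) → wellFormed a b c d e)
    (λ (wellFormed a b c d e) → a , b , c , d , e)
    (all? (λ p → all? λ i → row (column p i) i ≟ p)
     ×-dec all? (λ b → all? λ i → column (row b i) i ≟ b)
     ×-dec all? (λ b → all? λ i → all? λ j → (row b i ≟ row b j) →-dec (i ≟ j))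
     ×-dec all? (λ b → all? λ i → all? λ k → (column (row b i) k ≟ b) ⊎-dec
             all? (λ j → all? λ l → (row b j ≟ row (column (row b i) k) l) →-dec (i ≟ j)))
     ×-dec all? (λ b → any? λ i → toℕ (row (suc b) i) <? toℕ (suc b)))

module Tabulated {n} (t : Table n) (ok : WellFormed t) where
  private module W = WellFormed ok

  frame : Frame (Fin (suc n))
  frame = record
    { line        = row t
    ; pencil      = column t
    ; line-pencil = W.row-column
    ; pencil-line = W.column-row
    ; distinct    = λ b → W.distinct b _ _
    ; linear      = linear′
    }
    where
    linear′ : ∀ b b′ {i j k l} → i ≢ j →
              row t b i ≡ row t b′ k → row t b j ≡ row t b′ l → b ≡ b′
    linear′ b b′ {i} {j} {k} {l} i≢j eq eq′
      with trans (cong (λ p → column t p k) eq) (W.column-row b′ k) | W.linear b i k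
    ... | b″≡b′ | inj₁ b″≡b = trans (sym b″≡b) b″≡b′
    ... | b″≡b′ | inj₂ apart = contradiction
      (apart j l (trans eq′ (cong (λ c → row t c l) (sym b″≡b′)))) i≢j

  same : ∀ S → (∀ b → Uniform frame (_∈ S) (suc b)) → ∀ p → Acc _<_ (toℕ p) →
         (zero ∈ S → p ∈ S) × (p ∈ S → zero ∈ S)
  same S uniform zero    _         = id , id
  same S uniform (suc b) (acc rec) with W.descending b | uniform b
  ... | i , lt | inj₁ ∈S = (λ _ → ∈S zero) , λ _ → proj₂ (same S uniform _ (rec lt)) (∈S i)
  ... | i , lt | inj₂ ∉S = (λ 0∈ → contradiction (proj₁ (same S uniform _ (rec lt)) 0∈) (∉S i))
                         , λ p∈ → contradiction p∈ (∉S zero)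

  connected : Connected⁻ frame
  connected S uniform with zero ∈? S
  ... | yes 0∈ = inj₂ λ p → proj₁ (same S uniform p (<-wellFounded _)) 0∈
  ... | no  0∉ = inj₁ λ p → 0∉ ∘ proj₂ (same S uniform p (<-wellFounded _))

  clause : Fin (suc n) → Clause
  clause b = tabulate (toℕ ∘ row t b)

  clause⁻ : Clause
  clause⁻ = tabulate (toℕ ∘ row t zero ∘ suc)

  clauses others : List Clause
  clauses = tabulate clause
  others  = tabulate (clause ∘ suc)

  module _ {Q : Subset (suc n)} where

    meets⇒hit : ∀ {b} → Meets frame (_∈ Q) b → Hit (members Q) (clause b)
    meets⇒hit {b} (i , i∈) = _ , ∈-tabulate⁺ {f = toℕ ∘ row t b} i , ∈-members⁺ i∈

    leaves⇒miss : ∀ {b} → Leaves frame (_∈ Q) b → Miss (members Q) (clause b)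
    leaves⇒miss {b} (i , i∉) = _ , ∈-tabulate⁺ {f = toℕ ∘ row t b} i , ∉-members i∉

    meets⁻⇒hit : Meets⁻ frame Q → Hit (members Q) clause⁻
    meets⁻⇒hit (i , i∈) = _ , ∈-tabulate⁺ {f = toℕ ∘ row t zero ∘ suc} i , ∈-members⁺ i∈

    leaves⁻⇒miss : Leaves⁻ frame Q → Miss (members Q) clause⁻
    leaves⁻⇒miss (i , i∉) = _ , ∈-tabulate⁺ {f = toℕ ∘ row t zero ∘ suc} i , ∉-members i∉

  module _ (k : ℕ) (points : List ℕ) where

    witness : Subset (suc n)
    witness = Vec.tabulate λ x → does (toℕ x ∈ˡ? points)

    record Witness : Set where
      constructor isWitness
      field
        blocks : ∀ b → Blocked frame (_∈ witness) b
        size   : ∣ witness ∣ ≡ k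

    witness? : Dec Witness
    witness? = Dec.map′ (λ (a , b) → isWitness a b) (λ (isWitness a b) → a , b)
      (all? (λ b → any? (λ i → row t b i ∈? witness) ×-dec any? (λ i → ¬? (row t b i ∈? witness)))
       ×-dec (∣ witness ∣ ℕ.≟ k))

  module _ (k : ℕ) (points : List ℕ)
           (w      : does (witness? k points) ≡ true)
           (closed : certifies (suc n) (k ∸ 1) clauses clauses ≡ true) where

    number : BlockingNumber frame k
    number = record
      { connected = connected
      -- The certified inequality is strict, so the search runs with budget `k ∸ 1`.
      ; least     = λ Q blocks → ℕ.≤-trans (ℕ.m≤n+m∸n k 1) (certifies-sound (k ∸ 1) closed Q
          (All.tabulate⁺ (meets⇒hit ∘ proj₁ ∘ blocks))
          (All.tabulate⁺ (leaves⇒miss ∘ proj₂ ∘ blocks)))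
      ; Q*        = witness k points
      ; Q*-blocks = Witness.blocks (holds (witness? k points) w)
      ; Q*-size   = Witness.size (holds (witness? k points) w)
      }

    -- Slot zero of row `b` is `b`, so the flag point is point zero. The rest of block zero,
    -- `clause⁻`, must be hit when the foreign point is outside (`open₀`) and missed somewhere when
    -- it is inside (`open₁`).
    socket : does (¬? (zero ∈? witness k points)) ≡ true →
             certifies (suc n) (k ∸ 1) (clause⁻ ∷ others) others ≡ true →
             certifies (suc n) (k ∸ 2) others (clause⁻ ∷ others) ≡ true →
             Socket n k
    socket flag open₀ open₁ = record
      { frame  = frame
      ; number = number
      ; least₀ = λ Q blocks meets → ℕ.≤-trans (ℕ.m≤n+m∸n k 1)
          (certifies-sound (k ∸ 1) open₀ Q
            (meets⁻⇒hit meets ∷ All.tabulate⁺ (meets⇒hit ∘ proj₁ ∘ blocks))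
            (All.tabulate⁺ (leaves⇒miss ∘ proj₂ ∘ blocks)))
      -- The foreign point counts as one of the `k`, so excluding budget `k ∸ 2` suffices.
      ; least₁ = λ Q blocks leaves → ℕ.≤-trans (ℕ.m≤n+m∸n k 2)
          (s≤s (certifies-sound (k ∸ 2) open₁ Q
            (All.tabulate⁺ (meets⇒hit ∘ proj₁ ∘ blocks))
            (leaves⁻⇒miss leaves ∷ All.tabulate⁺ (leaves⇒miss ∘ proj₂ ∘ blocks))))
      ; flag∉  = holds (¬? (zero ∈? witness k points)) flag
      }

  -- The unit clause `0 ∷ []` forces the flag point into the set.
  plug : ∀ h points → does (witness? h points) ≡ true →
         does (¬? (zero ∈? witness h points)) ≡ true →
         certifies (suc n) (h ∸ 1) others [] ≡ true →
         certifies (suc n) h ((0 ∷ []) ∷ others) [] ≡ true →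
         Plug n h
  plug h points w flag any-size with-flag = record
    { frame     = frame
    ; connected = connected
    ; least     = λ Q meets → ℕ.≤-trans (ℕ.m≤n+m∸n h 1)
        (certifies-sound (h ∸ 1) any-size Q (All.tabulate⁺ (meets⇒hit ∘ meets)) [])
    ; least₁    = λ Q meets 0∈ → certifies-sound h with-flag Q
        ((0 , here refl , ∈-members⁺ 0∈) ∷ All.tabulate⁺ (meets⇒hit ∘ meets)) []
    ; Q*        = witness h points
    ; Q*-blocks = Witness.blocks (holds (witness? h points) w)
    ; Q*-size   = Witness.size (holds (witness? h points) w)
    ; flag∉     = holds (¬? (zero ∈? witness h points)) flag
    }

-- Tables and their certificates

table-9-3 : Table 8
table-9-3 =
  (2 , 8) ∷ (0 , 7) ∷ (1 , 6) ∷ (5 , 2) ∷ (3 , 0) ∷ (4 , 1) ∷ (8 , 5) ∷ (6 , 3) ∷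
  (7 , 4) ∷ []

-- Two points meet at most six of the eight blocks other than block zero. The points 1, 3 and 8 meet
-- each of the nine blocks exactly once, so they also form a blocking set.
plug-9-3 : Plug 8 3
plug-9-3 = Tabulated.plug table-9-3 (holds (wellFormed? table-9-3) refl) 3 (1 ∷ 3 ∷ 8 ∷ [])
  refl refl refl refl

-- table-v-k has v points and least blocking set size k; the tables were found by
-- local search over switchings of incidences.
table-8-4 : Table 7
table-8-4 =
  (2 , 4) ∷ (0 , 7) ∷ (1 , 6) ∷ (5 , 0) ∷ (3 , 1) ∷ (7 , 2) ∷ (4 , 5) ∷ (6 , 3) ∷ []

socket-8-4 : Socket 7 4
socket-8-4 = Tabulated.socket table-8-4 (holds (wellFormed? table-8-4) refl)
  4 (1 ∷ 2 ∷ 3 ∷ 5 ∷ [])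
  refl refl refl refl refl

table-9-4 : Table 8
table-9-4 =
  (4 , 8) ∷ (3 , 0) ∷ (1 , 7) ∷ (8 , 2) ∷ (2 , 6) ∷ (7 , 4) ∷ (0 , 5) ∷ (6 , 3) ∷
  (5 , 1) ∷ []

socket-9-4 : Socket 8 4
socket-9-4 = Tabulated.socket table-9-4 (holds (wellFormed? table-9-4) refl)
  4 (1 ∷ 3 ∷ 4 ∷ 5 ∷ [])
  refl refl refl refl refl

table-10-5 : Table 9
table-10-5 =
  (2 , 3) ∷ (9 , 0) ∷ (8 , 1) ∷ (1 , 7) ∷ (3 , 6) ∷ (4 , 2) ∷ (0 , 5) ∷ (6 , 9) ∷
  (7 , 4) ∷ (5 , 8) ∷ []

socket-10-5 : Socket 9 5
socket-10-5 = Tabulated.socket table-10-5 (holds (wellFormed? table-10-5) refl)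
  5 (1 ∷ 2 ∷ 4 ∷ 6 ∷ 9 ∷ [])
  refl refl refl refl refl

table-11-5 : Table 10
table-11-5 =
  (5 , 8) ∷ (9 , 0) ∷ (1 , 7) ∷ (2 , 6) ∷ (0 , 10) ∷ (3 , 4) ∷ (4 , 1) ∷ (6 , 9) ∷
  (10 , 3) ∷ (8 , 2) ∷ (7 , 5) ∷ []

socket-11-5 : Socket 10 5
socket-11-5 = Tabulated.socket table-11-5 (holds (wellFormed? table-11-5) refl)
  5 (1 ∷ 2 ∷ 5 ∷ 6 ∷ 10 ∷ [])
  refl refl refl refl refl

table-12-5 : Table 11
table-12-5 =
  (6 , 11) ∷ (0 , 7) ∷ (11 , 1) ∷ (9 , 2) ∷ (10 , 3) ∷ (2 , 0) ∷ (4 , 5) ∷ (3 , 6) ∷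
  (5 , 10) ∷ (1 , 8) ∷ (7 , 9) ∷ (8 , 4) ∷ []

socket-12-5 : Socket 11 5
socket-12-5 = Tabulated.socket table-12-5 (holds (wellFormed? table-12-5) refl)
  5 (1 ∷ 2 ∷ 4 ∷ 6 ∷ 10 ∷ [])
  refl refl refl refl refl

table-13-6 : Table 12
table-13-6 =
  (2 , 3) ∷ (5 , 0) ∷ (11 , 1) ∷ (1 , 8) ∷ (0 , 11) ∷ (3 , 6) ∷ (12 , 4) ∷ (4 , 10) ∷
  (10 , 2) ∷ (8 , 7) ∷ (6 , 9) ∷ (7 , 12) ∷ (9 , 5) ∷ []

socket-13-6 : Socket 12 6
socket-13-6 = Tabulated.socket table-13-6 (holds (wellFormed? table-13-6) refl)
  6 (1 ∷ 2 ∷ 3 ∷ 4 ∷ 7 ∷ 9 ∷ [])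
  refl refl refl refl refl

table-14-6 : Table 13
table-14-6 =
  (3 , 10) ∷ (0 , 5) ∷ (10 , 1) ∷ (6 , 2) ∷ (1 , 12) ∷ (8 , 3) ∷ (5 , 4) ∷ (12 , 6) ∷
  (9 , 7) ∷ (13 , 0) ∷ (7 , 13) ∷ (4 , 8) ∷ (11 , 9) ∷ (2 , 11) ∷ []

socket-14-6 : Socket 13 6
socket-14-6 = Tabulated.socket table-14-6 (holds (wellFormed? table-14-6) refl)
  6 (1 ∷ 3 ∷ 4 ∷ 6 ∷ 9 ∷ 13 ∷ [])
  refl refl refl refl refl

table-15-6 : Table 14
table-15-6 =
  (3 , 7) ∷ (6 , 0) ∷ (1 , 8) ∷ (4 , 1) ∷ (2 , 9) ∷ (14 , 2) ∷ (12 , 3) ∷ (5 , 6) ∷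
  (0 , 13) ∷ (8 , 12) ∷ (9 , 14) ∷ (7 , 10) ∷ (13 , 11) ∷ (10 , 5) ∷ (11 , 4) ∷ []

socket-15-6 : Socket 14 6
socket-15-6 = Tabulated.socket table-15-6 (holds (wellFormed? table-15-6) refl)
  6 (1 ∷ 3 ∷ 5 ∷ 8 ∷ 9 ∷ 11 ∷ [])
  refl refl refl refl refl

table-16-7 : Table 15
table-16-7 =
  (2 , 4) ∷ (0 , 6) ∷ (9 , 1) ∷ (14 , 2) ∷ (1 , 3) ∷ (4 , 14) ∷ (5 , 12) ∷ (11 , 5) ∷
  (6 , 11) ∷ (8 , 7) ∷ (7 , 15) ∷ (3 , 10) ∷ (15 , 0) ∷ (10 , 8) ∷ (12 , 13) ∷ (13 , 9) ∷
  []

socket-16-7 : Socket 15 7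
socket-16-7 = Tabulated.socket table-16-7 (holds (wellFormed? table-16-7) refl)
  7 (1 ∷ 2 ∷ 4 ∷ 7 ∷ 11 ∷ 12 ∷ 13 ∷ [])
  refl refl refl refl refl

table-12-6 : Table 11
table-12-6 =
  (6 , 11) ∷ (0 , 5) ∷ (8 , 0) ∷ (11 , 1) ∷ (1 , 6) ∷ (3 , 4) ∷ (2 , 9) ∷ (10 , 3) ∷
  (9 , 7) ∷ (4 , 10) ∷ (5 , 8) ∷ (7 , 2) ∷ []

-- The flag stays uncut here: this configuration serves `v = 12` alone, and `v = 21` has its own
-- table.
closed-12-6 : Σ (Frame (Fin 12)) λ F → BlockingNumber F 6
closed-12-6 = _ , Tabulated.number table-12-6 (holds (wellFormed? table-12-6) refl)
  6 (0 ∷ 1 ∷ 2 ∷ 3 ∷ 9 ∷ 10 ∷ [])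
  refl refl

table-15-7 : Table 14
table-15-7 =
  (3 , 5) ∷ (0 , 6) ∷ (14 , 0) ∷ (1 , 2) ∷ (6 , 3) ∷ (2 , 4) ∷ (5 , 14) ∷ (4 , 12) ∷
  (10 , 1) ∷ (7 , 8) ∷ (13 , 7) ∷ (9 , 10) ∷ (8 , 11) ∷ (12 , 9) ∷ (11 , 13) ∷ []

socket-15-7 : Socket 14 7
socket-15-7 = Tabulated.socket table-15-7 (holds (wellFormed? table-15-7) refl)
  7 (1 ∷ 3 ∷ 4 ∷ 7 ∷ 9 ∷ 11 ∷ 14 ∷ [])
  refl refl refl refl refl

table-16-8 : Table 15
table-16-8 =
  (3 , 4) ∷ (6 , 0) ∷ (0 , 11) ∷ (1 , 5) ∷ (2 , 7) ∷ (4 , 10) ∷ (13 , 3) ∷ (5 , 8) ∷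
  (11 , 1) ∷ (8 , 2) ∷ (7 , 12) ∷ (14 , 9) ∷ (15 , 6) ∷ (9 , 15) ∷ (12 , 13) ∷ (10 , 14) ∷
  []

closed-16-8 : Σ (Frame (Fin 16)) λ F → BlockingNumber F 8
closed-16-8 = _ , Tabulated.number table-16-8 (holds (wellFormed? table-16-8) refl)
  8 (0 ∷ 1 ∷ 2 ∷ 5 ∷ 7 ∷ 13 ∷ 14 ∷ 15 ∷ [])
  refl refl

table-17-8 : Table 16
table-17-8 =
  (4 , 8) ∷ (0 , 5) ∷ (1 , 6) ∷ (2 , 0) ∷ (3 , 1) ∷ (7 , 2) ∷ (5 , 4) ∷ (6 , 11) ∷
  (12 , 3) ∷ (8 , 16) ∷ (9 , 7) ∷ (15 , 10) ∷ (11 , 14) ∷ (16 , 12) ∷ (10 , 13) ∷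
  (13 , 9) ∷ (14 , 15) ∷ []

socket-17-8 : Socket 16 8
socket-17-8 = Tabulated.socket table-17-8 (holds (wellFormed? table-17-8) refl)
  8 (1 ∷ 2 ∷ 4 ∷ 7 ∷ 8 ∷ 10 ∷ 12 ∷ 15 ∷ [])
  refl refl refl refl refl

table-18-8 : Table 17
table-18-8 =
  (2 , 6) ∷ (0 , 9) ∷ (1 , 4) ∷ (17 , 1) ∷ (3 , 0) ∷ (9 , 2) ∷ (4 , 5) ∷ (6 , 3) ∷
  (7 , 14) ∷ (8 , 10) ∷ (12 , 7) ∷ (10 , 13) ∷ (11 , 8) ∷ (5 , 15) ∷ (16 , 12) ∷
  (14 , 17) ∷ (15 , 11) ∷ (13 , 16) ∷ []

socket-18-8 : Socket 17 8
socket-18-8 = Tabulated.socket table-18-8 (holds (wellFormed? table-18-8) refl)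
  8 (1 ∷ 2 ∷ 3 ∷ 5 ∷ 8 ∷ 10 ∷ 14 ∷ 16 ∷ [])
  refl refl refl refl refl

table-19-9 : Table 18
table-19-9 =
  (9 , 10) ∷ (0 , 7) ∷ (1 , 5) ∷ (2 , 0) ∷ (7 , 2) ∷ (4 , 3) ∷ (3 , 1) ∷ (5 , 6) ∷
  (6 , 4) ∷ (13 , 8) ∷ (8 , 14) ∷ (10 , 17) ∷ (11 , 9) ∷ (15 , 12) ∷ (16 , 13) ∷
  (18 , 11) ∷ (17 , 15) ∷ (14 , 18) ∷ (12 , 16) ∷ []

socket-19-9 : Socket 18 9
socket-19-9 = Tabulated.socket table-19-9 (holds (wellFormed? table-19-9) refl)
  9 (1 ∷ 2 ∷ 4 ∷ 6 ∷ 9 ∷ 10 ∷ 12 ∷ 14 ∷ 15 ∷ [])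
  refl refl refl refl refl

table-20-9 : Table 19
table-20-9 =
  (6 , 14) ∷ (15 , 0) ∷ (7 , 1) ∷ (2 , 15) ∷ (9 , 2) ∷ (0 , 10) ∷ (1 , 5) ∷ (11 , 6) ∷
  (4 , 7) ∷ (10 , 3) ∷ (8 , 17) ∷ (16 , 8) ∷ (3 , 11) ∷ (12 , 9) ∷ (13 , 4) ∷ (14 , 18) ∷
  (19 , 12) ∷ (5 , 19) ∷ (17 , 16) ∷ (18 , 13) ∷ []

socket-20-9 : Socket 19 9
socket-20-9 = Tabulated.socket table-20-9 (holds (wellFormed? table-20-9) refl)
  9 (1 ∷ 2 ∷ 4 ∷ 6 ∷ 8 ∷ 10 ∷ 12 ∷ 18 ∷ 19 ∷ [])
  refl refl refl refl refl

table-21-9 : Table 20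
table-21-9 =
  (2 , 5) ∷ (3 , 0) ∷ (1 , 20) ∷ (16 , 2) ∷ (0 , 11) ∷ (20 , 4) ∷ (5 , 1) ∷ (6 , 19) ∷
  (7 , 3) ∷ (8 , 6) ∷ (9 , 7) ∷ (19 , 10) ∷ (11 , 16) ∷ (10 , 12) ∷ (17 , 8) ∷ (12 , 14) ∷
  (13 , 15) ∷ (4 , 13) ∷ (15 , 17) ∷ (18 , 9) ∷ (14 , 18) ∷ []

socket-21-9 : Socket 20 9
socket-21-9 = Tabulated.socket table-21-9 (holds (wellFormed? table-21-9) refl)
  9 (1 ∷ 2 ∷ 4 ∷ 6 ∷ 7 ∷ 10 ∷ 14 ∷ 16 ∷ 18 ∷ [])
  refl refl refl refl refl

table-22-10 : Table 21
table-22-10 =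
  (3 , 7) ∷ (0 , 4) ∷ (19 , 0) ∷ (2 , 1) ∷ (5 , 3) ∷ (1 , 10) ∷ (7 , 2) ∷ (4 , 12) ∷
  (10 , 6) ∷ (8 , 5) ∷ (11 , 9) ∷ (13 , 8) ∷ (6 , 11) ∷ (9 , 19) ∷ (12 , 13) ∷ (14 , 20) ∷
  (21 , 14) ∷ (16 , 15) ∷ (15 , 21) ∷ (17 , 18) ∷ (18 , 16) ∷ (20 , 17) ∷ []

socket-22-10 : Socket 21 10
socket-22-10 = Tabulated.socket table-22-10 (holds (wellFormed? table-22-10) refl)
  10 (1 ∷ 3 ∷ 6 ∷ 8 ∷ 9 ∷ 12 ∷ 15 ∷ 16 ∷ 19 ∷ 20 ∷ [])
  refl refl refl refl refl

table-23-10 : Table 22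
table-23-10 =
  (3 , 4) ∷ (18 , 0) ∷ (0 , 7) ∷ (1 , 2) ∷ (6 , 1) ∷ (2 , 6) ∷ (7 , 3) ∷ (4 , 18) ∷
  (5 , 12) ∷ (11 , 5) ∷ (9 , 8) ∷ (12 , 10) ∷ (17 , 9) ∷ (8 , 11) ∷ (13 , 20) ∷
  (14 , 22) ∷ (21 , 14) ∷ (15 , 16) ∷ (10 , 17) ∷ (22 , 13) ∷ (16 , 19) ∷ (19 , 15) ∷
  (20 , 21) ∷ []

socket-23-10 : Socket 22 10
socket-23-10 = Tabulated.socket table-23-10 (holds (wellFormed? table-23-10) refl)
  10 (1 ∷ 3 ∷ 5 ∷ 7 ∷ 8 ∷ 10 ∷ 14 ∷ 17 ∷ 19 ∷ 20 ∷ [])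
  refl refl refl refl refl

table-25-11 : Table 24
table-25-11 =
  (3 , 4) ∷ (0 , 7) ∷ (22 , 0) ∷ (2 , 1) ∷ (1 , 5) ∷ (7 , 2) ∷ (5 , 3) ∷ (4 , 22) ∷
  (6 , 11) ∷ (12 , 6) ∷ (9 , 8) ∷ (13 , 9) ∷ (11 , 10) ∷ (8 , 12) ∷ (10 , 13) ∷
  (14 , 24) ∷ (15 , 20) ∷ (20 , 14) ∷ (24 , 17) ∷ (16 , 23) ∷ (19 , 18) ∷ (17 , 19) ∷
  (21 , 16) ∷ (18 , 15) ∷ (23 , 21) ∷ []

socket-25-11 : Socket 24 11
socket-25-11 = Tabulated.socket table-25-11 (holds (wellFormed? table-25-11) refl)
  11 (1 ∷ 3 ∷ 6 ∷ 7 ∷ 10 ∷ 13 ∷ 15 ∷ 17 ∷ 19 ∷ 22 ∷ 23 ∷ [])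
  refl refl refl refl refl

-- Assembly over all `v`

solution : ∀ {n k} {F : Frame (Fin (suc n))} → BlockingNumber F k →
           Σ (Config (suc n)) λ C → Connected C × MinBlockingSetSize C k
solution {F = F} N =
  config F , (λ S uniform → connected S (uniform ∘ suc)) , (Q* , Q*-blocks , Q*-size) , least
  where open BlockingNumber N

⌈9+v/3⌉ : ∀ v → ⌈ 9 + v /3⌉ ≡ 3 + ⌈ v /3⌉
⌈9+v/3⌉ v = +-distrib-/-∣ˡ {9} (v + 2) {3} (divides 3 refl)

-- Nine more points raise both the ceiling and the blocking number by three, so the excess `e`
-- persists.
step : ∀ {n} e → Socket n (⌈ suc n /3⌉ + e) → Socket (9 + n) (⌈ 10 + n /3⌉ + e)
step {n} e S = subst (λ c → Socket (9 + n) (c + e)) (sym (⌈9+v/3⌉ (suc n)))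
  (Insertion.inserted plug-9-3 S)

-- The base cases `v = 8` to `16` cover all residues modulo nine.
sockets₁ : ∀ n → Socket (7 + n) (⌈ 8 + n /3⌉ + 1)
sockets₁ 0 = socket-8-4
sockets₁ 1 = socket-9-4
sockets₁ 2 = socket-10-5
sockets₁ 3 = socket-11-5
sockets₁ 4 = socket-12-5
sockets₁ 5 = socket-13-6
sockets₁ 6 = socket-14-6
sockets₁ 7 = socket-15-6
sockets₁ 8 = socket-16-7
sockets₁ (suc (suc (suc (suc (suc (suc (suc (suc (suc n))))))))) = step 1 (sockets₁ n)

-- No flag of closed-16-8 admits the bounds of Socket, so v = 25 has its own table.
sockets₂ : ∀ n → Socket (16 + n) (⌈ 17 + n /3⌉ + 2)
sockets₂ 0 = socket-17-8
sockets₂ 1 = socket-18-8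
sockets₂ 2 = socket-19-9
sockets₂ 3 = socket-20-9
sockets₂ 4 = socket-21-9
sockets₂ 5 = socket-22-10
sockets₂ 6 = socket-23-10
-- `v = 24` comes from `v = 15` by one splice.
sockets₂ 7 = step 2 socket-15-7
sockets₂ 8 = socket-25-11
sockets₂ (suc (suc (suc (suc (suc (suc (suc (suc (suc n))))))))) = step 2 (sockets₂ n)

Solution : ℕ → ℕ → Set
Solution e v = Σ (Config v) λ C → Connected C × MinBlockingSetSize C (⌈ v /3⌉ + e)

solutions₁ : ∀ n → Solution 1 (8 + n)
solutions₁ n = solution (Socket.number (sockets₁ n))

-- `v = 16` has no socket here, so the unbroken family of sockets begins at 17, and 15 and 16 are
-- treated separately.
solutions₂ : ∀ n → Solution 2 (15 + n)
solutions₂ 0             = solution (Socket.number socket-15-7)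
solutions₂ 1             = solution (proj₂ closed-16-8)
solutions₂ (suc (suc n)) = solution (Socket.number (sockets₂ n))

theorem4 : ((v : ℕ) → 8 ≤ v →
    Σ (Config v) λ C → Connected C × MinBlockingSetSize C (⌈ v /3⌉ + 1))
    ×
    ((v : ℕ) → (v ≡ 12 ⊎ 15 ≤ v) →
    Σ (Config v) λ C → Connected C × MinBlockingSetSize C (⌈ v /3⌉ + 2))
theorem4 =
  (λ v 8≤v → subst (Solution 1) (ℕ.m+[n∸m]≡n 8≤v) (solutions₁ (v ∸ 8))) ,
  λ { v (inj₁ refl) → solution (proj₂ closed-12-6)
    ; v (inj₂ 15≤v) → subst (Solution 2) (ℕ.m+[n∸m]≡n 15≤v) (solutions₂ (v ∸ 15)) }
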